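{- Let $$S_0=\begin{pmatrix}1&0&1&0\\1&0&0&1\\0&1&0&1\end{pmatrix},\qquad S_1=\begin{pmatrix}1&0&0&1\\1&0&1&0\\0&1&0&1\end{pmatrix}.$$ Then $\mathrm{Ex}(S_0,n)\ge n2^{\sqrt{\log n}-O(\log\log n)}$ and $\mathrm{Ex}(S_1,n)\ge n2^{\sqrt{\log n}-O(\log\log n)}$; that is, there are constants $C,n_0$ such that for all $n\ge n_0$ both $\mathrm{Ex}(S_0,n)$ and $\mathrm{Ex}(S_1,n)$ are at least $n2^{\sqrt{\log n}-C\log\log n}$.
   Context: A pattern is a 0--1 matrix. A 0--1 matrix $A$ contains a pattern $P$ if $A$ can be transformed into $P$ by removing rows and columns from $A$ (keeping the order of the remaining ones) and changing some 1s to 0s; otherwise $A$ is $P$-free. $\mathrm{Ex}(P,n)$ is the maximum number of 1s in an $n\times n$ 0--1 matrix that is $P$-free. $\log$ is the binary logarithm. -}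

module Defs where

open import Algebra.Definitions.RawSemiring using () renaming (_^_ to pow)
open import Data.Bool.Base as Bool using (Bool; true; false)
import Data.Bool.Properties as Bool
open import Data.Fin.Base as Fin using (Fin)
import Data.Fin.Properties as Fin
open import Data.Integer.Base as ℤ using (ℤ; -[1+_])
open import Data.List.Base as List using (List; cartesianProductWith; filter)
open import Data.List.Extrema.Nat using (max; argmax-sel; xs≤max)
open import Data.List.Membership.Propositional using (_∈_)
open import Data.List.Membership.Propositional.Properties
  using (∈-cartesianProductWith⁺; ∈-filter⁺; ∈-map⁺; ∈-map⁻; ∈-filter⁻)
open import Data.List.Relation.Unary.All as All using ()
open import Data.List.Relation.Unary.Any using (here; there)
open import Data.Nat.Base as ℕ using (ℕ; zero; suc)
import Data.Nat.Properties as ℕ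
open import Data.Product.Base using (Σ; ∃; _×_; _,_)
open import Data.Rational.Base as ℚ
  using (ℚ; 0ℚ; ½; _*_; _-_; _<_; _≤_; ↥_; ↧ₙ_; +-*-rawSemiring)
open import Data.Sum.Base using (_⊎_; inj₁; inj₂)
open import Data.Vec.Base as Vec using (Vec; []; _∷_; lookup; count)
open import Function.Base using (_∘_; id)
open import Relation.Binary.Core using (_Preserves_⟶_)
open import Relation.Binary.PropositionalEquality using (_≡_; refl; subst; subst₂; sym; trans)
open import Relation.Nullary.Decidable using (Dec; T?; ¬?; map′; _×-dec_; _→-dec_)
open import Relation.Nullary.Negation using (¬_)

private
  variable
    k l m n : ℕ

------------------------------------------------------------------------
-- 0–1 matrices and pattern containment

Matrix : ℕ → ℕ → Set
Matrix m n = Vec (Vec Bool n) m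

entry : Matrix m n → Fin m → Fin n → Bool
entry A i j = lookup (lookup A i) j

weight : Matrix m n → ℕ
weight A = Vec.sum (Vec.map (count T?) A)

-- The rows and columns that are kept are the ranges of the strictly increasing
-- maps r and c; Bool._≤_ is the order false ≤ true, so the remaining matrix
-- may have additional 1s.

Embeds : Matrix k l → Matrix m n → (Fin k → Fin m) → (Fin l → Fin n) → Set
Embeds P A r c =
  r Preserves Fin._<_ ⟶ Fin._<_ ×
  c Preserves Fin._<_ ⟶ Fin._<_ ×
  (∀ i j → entry P i j Bool.≤ entry A (r i) (c j))

_Contains_ : Matrix m n → Matrix k l → Set
_Contains_ {m} {n} {k} {l} A P =
  Σ (Fin k → Fin m) λ r → Σ (Fin l → Fin n) λ c → Embeds P A r c

_Avoids_ : Matrix m n → Matrix k l → Set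
A Avoids P = ¬ (A Contains P)

------------------------------------------------------------------------
-- Decidability of containment

private
  increasing? : (f : Fin k → Fin m) → Dec (f Preserves Fin._<_ ⟶ Fin._<_)
  increasing? f =
    map′ (λ h {i} {j} → h i j) (λ h i j → h {i} {j})
      (Fin.all? λ i → Fin.all? λ j → (i Fin.<? j) →-dec (f i Fin.<? f j))

  embeds? : (P : Matrix k l) (A : Matrix m n) (r : Fin k → Fin m) (c : Fin l → Fin n) →
            Dec (Embeds P A r c)
  embeds? P A r c =
    increasing? r ×-dec increasing? c ×-dec
    Fin.all? λ i → Fin.all? λ j → entry P i j Bool.≤? entry A (r i) (c j)

  Embeds-resp : (P : Matrix k l) (A : Matrix m n)
                {r r′ : Fin k → Fin m} {c c′ : Fin l → Fin n} →
                (∀ i → r i ≡ r′ i) → (∀ j → c j ≡ c′ j) →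
                Embeds P A r c → Embeds P A r′ c′
  Embeds-resp P A r≗ c≗ (r↑ , c↑ , P≤A) =
    (λ {i} {j} i<j → subst₂ Fin._<_ (r≗ i) (r≗ j) (r↑ i<j)) ,
    (λ {i} {j} i<j → subst₂ Fin._<_ (c≗ i) (c≗ j) (c↑ i<j)) ,
    (λ i j → subst₂ (λ a b → entry P i j Bool.≤ entry A a b) (r≗ i) (c≗ j) (P≤A i j))

contains? : (A : Matrix m n) (P : Matrix k l) → Dec (A Contains P)
contains? A P =
  map′ (λ (s , t , e) → Fin.finToFun s , Fin.finToFun t , e)
       (λ (r , c , e) → Fin.funToFin r , Fin.funToFin c ,
          Embeds-resp P A (sym ∘ Fin.finToFun-funToFin r) (sym ∘ Fin.finToFun-funToFin c) e)
       (Fin.any? λ s → Fin.any? λ t → embeds? P A (Fin.finToFun s) (Fin.finToFun t))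

avoids? : (P : Matrix k l) (A : Matrix m n) → Dec (A Avoids P)
avoids? P A = ¬? (contains? A P)

------------------------------------------------------------------------
-- The extremal function

allVecs : {X : Set} → List X → ∀ n → List (Vec X n)
allVecs xs zero    = List.[ [] ]
allVecs xs (suc n) = cartesianProductWith _∷_ xs (allVecs xs n)

allMatrices : ∀ m n → List (Matrix m n)
allMatrices m n = allVecs (allVecs (true List.∷ false List.∷ List.[]) n) m

-- The default value 0 only matters if no n × n matrix avoids P (for instance,
-- if P is a small all-0 pattern).

Ex : Matrix k l → ℕ → ℕ
Ex P n = max 0 (List.map weight (filter (avoids? P) (allMatrices n n)))

∈-allVecs : {X : Set} {xs : List X} → (∀ x → x ∈ xs) → ∀ {n} (v : Vec X n) → v ∈ allVecs xs n
∈-allVecs all []      = here refl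
∈-allVecs all (x ∷ v) = ∈-cartesianProductWith⁺ _∷_ (all x) (∈-allVecs all v)

∈-allMatrices : (A : Matrix m n) → A ∈ allMatrices m n
∈-allMatrices = ∈-allVecs (∈-allVecs λ { true → here refl ; false → there (here refl) })

weight≤Ex : (P : Matrix k l) (A : Matrix n n) → A Avoids P → weight A ℕ.≤ Ex P n
weight≤Ex {n = n} P A free =
  All.lookup (xs≤max 0 _) (∈-map⁺ weight (∈-filter⁺ (avoids? P) (∈-allMatrices A) free))

Ex-attained : (P : Matrix k l) (A : Matrix n n) → A Avoids P →
              ∃ λ (B : Matrix n n) → B Avoids P × weight B ≡ Ex P n
Ex-attained {n = n} P A free
  with argmax-sel id 0 (List.map weight (filter (avoids? P) (allMatrices n n)))
... | inj₁ Ex≡0 =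
  A , free , trans (ℕ.n≤0⇒n≡0 (subst (weight A ℕ.≤_) Ex≡0 (weight≤Ex P A free))) (sym Ex≡0)
... | inj₂ Ex∈ with ∈-map⁻ weight Ex∈
...   | B , B∈ , Ex≡w with ∈-filter⁻ (avoids? P) {xs = allMatrices n n} B∈
...     | _ , B-free = B , B-free , sym Ex≡w

------------------------------------------------------------------------
-- The two patterns

private
  pattern I = true
  pattern O = false

S₀ : Matrix 3 4
S₀ = (I ∷ O ∷ I ∷ O ∷ [])
   ∷ (I ∷ O ∷ O ∷ I ∷ [])
   ∷ (O ∷ I ∷ O ∷ I ∷ [])
   ∷ []

S₁ : Matrix 3 4
S₁ = (I ∷ O ∷ O ∷ I ∷ [])
   ∷ (I ∷ O ∷ I ∷ O ∷ [])
   ∷ (O ∷ I ∷ O ∷ I ∷ [])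
   ∷ []

------------------------------------------------------------------------
-- Powers of two with rational exponents, compared with rationals

infixr 8 _^_
_^_ : ℚ → ℕ → ℚ
_^_ = pow +-*-rawSemiring

2^ℤ : ℤ → ℚ
2^ℤ (ℤ.+ n)  = (ℤ.+ 2 ℚ./ 1) ^ n
2^ℤ -[1+ n ] = ½ ^ suc n

-- p ≤ 2^q and p ≥ 2^q; for p > 0 and q = a/b with b > 0, the comparison of p
-- with 2^(a/b) is that of p^b with 2^a.

infix 4 _≤2^_ _≥2^_

_≤2^_ : ℚ → ℚ → Set
p ≤2^ q = p ≤ 0ℚ ⊎ p ^ ↧ₙ q ≤ 2^ℤ (↥ q)

_≥2^_ : ℚ → ℚ → Set
p ≥2^ q = 0ℚ < p × 2^ℤ (↥ q) ≤ p ^ ↧ₙ q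

------------------------------------------------------------------------
-- Real numbers

-- A real number x is represented by its Dedekind cut: the rationals q < x and
-- the rationals q > x.  The cut axioms are not part of the record, so that the
-- operations below are total; log₂ is meant for x ≥ 0 (with log₂ 0 = -∞, whose
-- lower set is empty and whose upper set is everything) and √ for x ≥ 0.
-- Each operation sends the cut of a real in its domain to the cut of the value.

record Cut : Set₁ where
  field
    Lower : ℚ → Set
    Upper : ℚ → Set

open Cut public

fromℕ : ℕ → Cut
fromℕ n .Lower q = q < ℤ.+ n ℚ./ 1
fromℕ n .Upper q = ℤ.+ n ℚ./ 1 < q

infixl 7 _·_
infixl 6 _⊖_
infix  4 _⊑_

_·_ : ℕ → Cut → Cut
(k · x) .Lower q = ∃ λ r → Lower x r × q < (ℤ.+ k ℚ./ 1) * r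
(k · x) .Upper q = ∃ λ r → Upper x r × (ℤ.+ k ℚ./ 1) * r < q

_⊖_ : Cut → Cut → Cut
(x ⊖ y) .Lower q = ∃ λ r → ∃ λ s → Lower x r × Upper y s × q < r - s
(x ⊖ y) .Upper q = ∃ λ r → ∃ λ s → Upper x r × Lower y s × r - s < q

√ : Cut → Cut
√ x .Lower q = q < 0ℚ ⊎ Lower x (q * q)
√ x .Upper q = 0ℚ < q × Upper x (q * q)

2^ : Cut → Cut
2^ x .Lower p = ∃ λ q → Lower x q × p ≤2^ q
2^ x .Upper p = ∃ λ q → Upper x q × p ≥2^ q

log₂ : Cut → Cut
log₂ x .Lower q = ∃ λ r → Lower x r × r ≥2^ q
log₂ x .Upper q = ∃ λ r → Upper x r × r ≤2^ q

-- The order x ≤ y of real numbers.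

_⊑_ : Cut → Cut → Set
x ⊑ y = ∀ q → Lower x q → Lower y q

module Submission where

-- Fix U = 2ᵐ and index rows by (u, x₁, …, xₘ) with u < U and columns by
-- (y₁, t₁, …, yₘ, tₘ) with tᵢ ∈ {0, 1}, both lexicographically ordered; put a 1
-- where yᵢ = xᵢ + tᵢ u for all i.  A row has 2ᵐ ones, and two rows that share a
-- column have distinct u, ordered like the rows.  Suppose a < b < c < d, rows
-- P and Q meet in a, P also meets c, Q and R meet in d, R also meets b, and Q
-- comes before R, as in both patterns (the order of P and Q is irrelevant).
-- Look at the first pair (y, t) in which a and d differ.  Then a has t = 0 and
-- d has t = 1, so d is ahead of a by u_Q.  If b still agrees with a, then u_R
-- = u_Q; if b is at y_d − u_R with t = 0 it lies before a, as u_R > u_Q. So b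
-- agrees with d, hence so does c, and u_P = u_Q: a contradiction.
--
-- Placing copies of the matrix along the diagonal and choosing the range of the
-- xᵢ to be about p = log log n bits longer than u gives Ex(n) ≥ 2ᵐ n / 4 with
-- m = √(log n) − O(log log n).

open import Defs renaming (_^_ to infixr 8 _^ℚ_)
open import Algebra.Bundles using (CommutativeRing)
import Algebra.Properties.Semiring.Exp as Exp
open import Data.Bool.Base as Bool using (true; false; T)
open import Data.Bool.Properties using (T-≡)
open import Data.Empty using (⊥-elim)
open import Data.Fin using (Fin; zero; suc; toℕ; fromℕ<; #_)
open import Data.Fin.Properties using (toℕ-fromℕ<)
open import Data.Integer.Base as ℤ using (ℤ; -[1+_])
import Data.Integer.Properties as ℤ
open import Data.List.Base using (List; []; _∷_; [_]; _++_; map; length)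
open import Data.List.Membership.Propositional using (_∈_)
open import Data.List.Membership.Propositional.Properties using (∈-++⁻; ∈-map⁻)
open import Data.List.Properties using (length-++; length-map)
open import Data.List.Relation.Binary.Disjoint.Propositional using (Disjoint)
open import Data.List.Relation.Unary.All as All using (All; []; _∷_)
open import Data.List.Relation.Unary.AllPairs using ([]; _∷_)
open import Data.List.Relation.Unary.Any using (here)
open import Data.List.Relation.Unary.Unique.Propositional using (Unique)
open import Data.List.Relation.Unary.Unique.Propositional.Properties using (map⁺; ++⁺)
open import Data.Nat.Base
open import Data.Nat.Coprimality using (1-coprimeTo) renaming (sym to coprime-sym)
open import Data.Nat.DivMod
open import Data.Nat.Properties
open import Data.List.Membership.DecPropositional _≟_ using (_∈?_)
open import Data.Nat.Tactic.RingSolver using (solve-∀)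
open import Data.Product.Base using (Σ; ∃; _×_; _,_; proj₂)
open import Data.Rational.Base as ℚ using (ℚ; mkℚ; ½; 0ℚ; 1ℚ; *≤*)
import Data.Rational.Properties as ℚ
open import Data.Sum.Base using (_⊎_; inj₁; inj₂)
open import Data.Vec.Base as Vec using (Vec; []; _∷_; lookup; tabulate; count; _[_]≔_)
open import Data.Vec.Properties using (lookup∘tabulate; lookup∘updateAt′)
open import Function.Base using (_∘_)
open import Function.Bundles using (Equivalence)
open import Relation.Binary.PropositionalEquality hiding ([_])
open import Relation.Nullary.Decidable using (Dec; yes; no; does; T?; dec-true)
open import Relation.Nullary.Negation using (¬_)
open Exp (CommutativeRing.semiring ℚ.+-*-commutativeRing) using (^-assocʳ)

-- Counting ones

count-clear : ∀ {n} (v : Vec _ n) i → lookup v i ≡ true →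
              suc (count T? (v [ i ]≔ false)) ≡ count T? v
count-clear (true  ∷ v) zero    _  = refl
count-clear (true  ∷ v) (suc i) vᵢ = cong suc (count-clear v i vᵢ)
count-clear (false ∷ v) (suc i) vᵢ = count-clear v i vᵢ

-- Each listed position is cleared once it has been counted; distinctness keeps the later ones true.
length≤count : ∀ {n} (v : Vec _ n) {xs} → Unique xs →
               All (λ x → ∃ λ i → toℕ i ≡ x × lookup v i ≡ true) xs →
               length xs ≤ count T? v
length≤count v [] [] = z≤n
length≤count v (x∉xs ∷ xs!) ((i , i≡x , vᵢ) ∷ vs) =
  subst (_ ≤_) (count-clear v i vᵢ)
    (s≤s (length≤count (v [ i ]≔ false) xs! (All.zipWith still-true (x∉xs , vs))))
  where
  still-true : ∀ {y} → _ × (∃ λ j → toℕ j ≡ y × lookup v j ≡ true) →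
               ∃ λ j → toℕ j ≡ y × lookup (v [ i ]≔ false) j ≡ true
  still-true (x≢y , j , j≡y , vⱼ) =
    j , j≡y , trans (lookup∘updateAt′ j i (λ j≡i → x≢y (trans (sym i≡x) (trans (cong toℕ (sym j≡i)) j≡y))) v) vⱼ

R*d≤sum : ∀ {n R d} (f : Fin n → ℕ) → R ≤ n → (∀ i → toℕ i < R → d ≤ f i) →
          R * d ≤ Vec.sum (tabulate f)
R*d≤sum {R = zero}  f _         _ = z≤n
R*d≤sum {R = suc R} f (s≤s R≤n) h =
  +-mono-≤ (h zero z<s) (R*d≤sum (f ∘ suc) R≤n (λ i i<R → h (suc i) (s<s i<R)))

sum-map-tabulate : ∀ {A : Set} {n} (g : A → ℕ) (f : Fin n → A) →
                   Vec.sum (Vec.map g (tabulate f)) ≡ Vec.sum (tabulate (g ∘ f))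
sum-map-tabulate {n = zero}  g f = refl
sum-map-tabulate {n = suc n} g f = cong (g (f zero) +_) (sum-map-tabulate g (f ∘ suc))

-- The matrix

-- If d < c, then t + d B < (d + 1) B ≤ c B, as t is a digit. This passes from the order of columns
-- to that of their leading parts.
quot-mono : ∀ {B s t} c d → t < B → s + c * B ≤ t + d * B → c ≤ d
quot-mono {B} {s} {t} c d t<B le = ≮⇒≥ λ d<c → <⇒≱ (begin-strict
  t + d * B   <⟨ +-monoˡ-< (d * B) t<B ⟩
  suc d * B   ≤⟨ *-monoˡ-≤ B d<c ⟩
  c * B       ≤⟨ m≤n+m (c * B) s ⟩
  s + c * B   ∎) le
  where open ≤-Reasoning

digits-unique : ∀ {B s t} c d → s < B → t < B → s + c * B ≡ t + d * B → c ≡ d × s ≡ t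
digits-unique {B} {s} {t} c d s<B t<B eq
  with refl ← ≤-antisym (quot-mono c d t<B (≤-reflexive eq)) (quot-mono d c s<B (≤-reflexive (sym eq)))
  = refl , +-cancelʳ-≡ (c * B) s t eq

-- The digits 2y and 2y + 1 stand for the pairs (y, 0) and (y, 1).
Digit : ℕ → ℕ → ℕ → Set
Digit x u s = s ≡ 2 * x ⊎ s ≡ suc (2 * (x + u))

double-mono⁻ : ∀ {m n} → 2 * m ≤ 2 * n → m ≤ n
double-mono⁻ {m} {n} = *-cancelˡ-≤ {m} {n} 2

double-inj : ∀ {m n} → 2 * m ≡ 2 * n → m ≡ n
double-inj {m} {n} = *-cancelˡ-≡ m n 2

-- If a and d are different digits of row Q, their order forces a = 2q and d = 2(q + v) + 1. By
-- parity p = q and r + w = q + v. If b = 2r, then a ≤ b gives q ≤ r, against v < w. Otherwise b =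
-- d, hence c = d, and p + u = q + v gives u = v.
digits-rigid : ∀ {p u q v r w a b c d} → u ≢ v → v < w →
               Digit p u a → Digit p u c → Digit q v a → Digit q v d → Digit r w b → Digit r w d →
               a ≤ b → b ≤ c → c ≤ d → a ≡ d
digits-rigid _ _ _ _ (inj₁ refl) (inj₁ refl) _ _ _ _ _ = refl
digits-rigid _ _ _ _ (inj₂ refl) (inj₂ refl) _ _ _ _ _ = refl
digits-rigid {q = q} {v} _ _ _ _ (inj₂ refl) (inj₁ refl) _ _ a≤b b≤c c≤d =
  ⊥-elim (<⇒≱ (s≤s (*-monoʳ-≤ 2 (m≤m+n q v))) (≤-trans a≤b (≤-trans b≤c c≤d)))
digits-rigid {p} {u} {q} _ _ (inj₂ pa) _ (inj₁ refl) (inj₂ refl) _ _ _ _ _ =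
  ⊥-elim (even≢odd q (p + u) pa)
digits-rigid {q = q} {v} {r} _ _ (inj₁ _) _ (inj₁ refl) (inj₂ refl) _ (inj₁ rd) _ _ _ =
  ⊥-elim (even≢odd r (q + v) (sym rd))
digits-rigid {q = q} {v} {r} {w} _ v<w (inj₁ _) _ (inj₁ refl) (inj₂ refl) (inj₁ refl) (inj₂ rd) a≤b _ _ =
  ⊥-elim (<-irrefl (double-inj {q + v} {r + w} (suc-injective rd))
                   (+-mono-≤-< (double-mono⁻ {q} {r} a≤b) v<w))
digits-rigid {p} {u} {q} {v} u≢v _ (inj₁ pa) Pc (inj₁ refl) (inj₂ refl) (inj₂ refl) (inj₂ rd) _ b≤c c≤d
  with refl ← ≤-antisym c≤d (≤-trans (≤-reflexive rd) b≤c) | Pc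
... | inj₁ pc = ⊥-elim (even≢odd p (q + v) (sym pc))
... | inj₂ pc with refl ← double-inj {q} {p} pa =
  ⊥-elim (u≢v (sym (+-cancelˡ-≡ q v u (double-inj (suc-injective pc)))))

module Construction (U K : ℕ) .{{_ : NonZero U}} .{{_ : NonZero K}} where

  -- A row number is ((q U + u) K + x₁) K + …, where q numbers the copies of the
  -- matrix, and a column number is (q B + s₁) B + …; there are k digits xᵢ and sᵢ.
  B : ℕ
  B = 2 * (K + U)

  label : ℕ → ℕ → ℕ
  label zero    r = r % U
  label (suc k) r = label k (r / K)

  columns : ℕ → ℕ → List ℕ
  -- With no digits left, only the copy number q remains, so the copies lie along the diagonal.
  columns zero    r = [ r / U ]
  columns (suc k) r =
    map (λ c → 2 * (r % K) + c * B) (columns k (r / K)) ++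
    map (λ c → suc (2 * (r % K + label k (r / K))) + c * B) (columns k (r / K))

  label<U : ∀ k r → label k r < U
  label<U zero    r = m%n<n r U
  label<U (suc k) r = label<U k (r / K)

  -- The reason for the value of `B`: a digit is 2y + t with t ≤ 1 and y ≤ x + u < K + U - 1.
  digit<B : ∀ {x u s} → x < K → u < U → Digit x u s → s < B
  digit<B {x} {u} x<K u<U (inj₁ refl) = *-monoʳ-< 2 (<-≤-trans x<K (m≤m+n K U))
  digit<B {x} {u} x<K u<U (inj₂ refl) = begin-strict
    suc (2 * (x + u))  <⟨ n<1+n _ ⟩
    2 + 2 * (x + u)    ≡⟨ *-suc 2 (x + u) ⟨
    2 * suc (x + u)    ≤⟨ *-monoʳ-≤ 2 (+-mono-< x<K u<U) ⟩
    B                  ∎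
    where open ≤-Reasoning

  split : ∀ k r {c} → c ∈ columns (suc k) r →
          ∃ λ c′ → ∃ λ s → c′ ∈ columns k (r / K) × Digit (r % K) (label k (r / K)) s ×
          s < B × c ≡ s + c′ * B
  split k r c∈ with ∈-++⁻ (map _ (columns k (r / K))) c∈
  ... | inj₁ c∈₀ with c′ , c′∈ , refl ← ∈-map⁻ _ c∈₀ =
    c′ , _ , c′∈ , inj₁ refl , digit<B (m%n<n r K) (label<U k (r / K)) (inj₁ refl) , refl
  ... | inj₂ c∈₁ with c′ , c′∈ , refl ← ∈-map⁻ _ c∈₁ =
    c′ , _ , c′∈ , inj₂ refl , digit<B (m%n<n r K) (label<U k (r / K)) (inj₂ refl) , refl

  -- Within each half the leading parts differ; the two halves differ in the parity of the last
  -- digit, even if u = 0.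
  columns-unique : ∀ k r → Unique (columns k r)
  columns-unique zero    r = [] ∷ []
  columns-unique (suc k) r =
    ++⁺ (map⁺ (λ {c} {d} → cancel {s = 2 * x} c d) rec)
        (map⁺ (λ {c} {d} → cancel {s = suc (2 * (x + u))} c d) rec)
        disjoint
    where
    x = r % K
    u = label k (r / K)
    rec = columns-unique k (r / K)
    bound : ∀ {s} → Digit x u s → s < B
    bound = digit<B (m%n<n r K) (label<U k (r / K))
    instance
      B≢0 : NonZero B
      B≢0 = >-nonZero (≤-<-trans z≤n (bound (inj₁ refl)))
    cancel : ∀ {s} c d → s + c * B ≡ s + d * B → c ≡ d
    cancel {s} c d eq = *-cancelʳ-≡ c d B (+-cancelˡ-≡ s (c * B) (d * B) eq)
    disjoint : Disjoint (map (λ c → 2 * x + c * B) (columns k (r / K)))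
                        (map (λ c → suc (2 * (x + u)) + c * B) (columns k (r / K)))
    disjoint (c∈₀ , c∈₁)
      with c , _ , refl ← ∈-map⁻ _ c∈₀ | d , _ , eq ← ∈-map⁻ _ c∈₁ =
      even≢odd x (x + u) (proj₂ (digits-unique c d (bound (inj₁ refl)) (bound (inj₂ refl)) eq))

  length-columns : ∀ k r → length (columns k r) ≡ 2 ^ k
  length-columns zero    r = refl
  length-columns (suc k) r = begin
    length (columns (suc k) r)       ≡⟨ length-++ (map _ cs) ⟩
    length (map _ cs) + length (map _ cs) ≡⟨ cong₂ _+_ (length-map _ cs) (length-map _ cs) ⟩
    length cs + length cs            ≡⟨ cong (λ l → l + l) (length-columns k (r / K)) ⟩
    2 ^ k + 2 ^ k                    ≡⟨ cong (2 ^ k +_) (+-identityʳ (2 ^ k)) ⟨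
    2 ^ suc k                        ∎
    where
    open ≡-Reasoning
    cs = columns k (r / K)

  columns<L*B^k : ∀ {L} k r → r < L * U * K ^ k → ∀ {c} → c ∈ columns k r → c < L * B ^ k
  columns<L*B^k {L} zero r r< (here refl) =
    subst (r / U <_) (sym (*-identityʳ L)) (m<n*o⇒m/o<n {n = L} (subst (r <_) (*-identityʳ (L * U)) r<))
  columns<L*B^k {L} (suc k) r r< c∈ with c′ , s , c′∈ , _ , s<B , refl ← split k r c∈ = begin-strict
    s + c′ * B      <⟨ +-monoˡ-< (c′ * B) s<B ⟩
    suc c′ * B      ≤⟨ *-monoˡ-≤ B (columns<L*B^k {L} k (r / K) r/K< c′∈) ⟩
    L * B ^ k * B   ≡⟨ reassoc L (B ^ k) B ⟩
    L * B ^ suc k   ∎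
    where
    open ≤-Reasoning
    reassoc : ∀ a b c → a * b * c ≡ a * (c * b)
    reassoc = solve-∀
    r/K< : r / K < L * U * K ^ k
    r/K< = m<n*o⇒m/o<n {n = L * U * K ^ k} (subst (r <_) (sym (reassoc (L * U) (K ^ k) K)) r<)

  -- The last digit is removed from both rows and from the shared column. If the shortened rows
  -- coincided, their labels would too, and the common last digit would then determine x, so that P
  -- = Q. At the end both rows lie in the same copy, where u orders them.
  label-mono : ∀ k {P Q c} → P < Q → c ∈ columns k P → c ∈ columns k Q → label k P < label k Q
  label-mono zero {P} {Q} P<Q (here refl) (here eq) = +-cancelʳ-< (P / U * U) (P % U) (Q % U) (begin-strict
    P % U + P / U * U  ≡⟨ m≡m%n+[m/n]*n P U ⟨
    P                  <⟨ P<Q ⟩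
    Q                  ≡⟨ m≡m%n+[m/n]*n Q U ⟩
    Q % U + Q / U * U  ≡⟨ cong (λ q → Q % U + q * U) eq ⟨
    Q % U + P / U * U  ∎)
    where open ≤-Reasoning
  label-mono (suc k) {P} {Q} P<Q c∈P c∈Q
    with c , s , c∈P′ , Ps , s<B , refl ← split k P c∈P
       | d , t , c∈Q′ , Qt , t<B , eq ← split k Q c∈Q
    with refl , refl ← digits-unique c d s<B t<B eq
    with m≤n⇒m<n∨m≡n (/-monoˡ-≤ K (<⇒≤ P<Q))
  ... | inj₁ P′<Q′ = label-mono k P′<Q′ c∈P′ c∈Q′
  ... | inj₂ P′≡Q′ = ⊥-elim (<⇒≢ P<Q (begin
    P                  ≡⟨ m≡m%n+[m/n]*n P K ⟩
    P % K + P / K * K  ≡⟨ cong₂ (λ x q → x + q * K) (same-x Ps Qt) P′≡Q′ ⟩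
    Q % K + Q / K * K  ≡⟨ m≡m%n+[m/n]*n Q K ⟨
    Q                  ∎))
    where
    open ≡-Reasoning
    same-x : ∀ {s} → Digit (P % K) (label k (P / K)) s → Digit (Q % K) (label k (Q / K)) s → P % K ≡ Q % K
    same-x (inj₁ refl) (inj₁ e) = double-inj {P % K} {Q % K} e
    same-x (inj₁ refl) (inj₂ e) = ⊥-elim (even≢odd (P % K) (Q % K + label k (Q / K)) e)
    same-x (inj₂ refl) (inj₁ e) = ⊥-elim (even≢odd (Q % K) (P % K + label k (P / K)) (sym e))
    same-x (inj₂ refl) (inj₂ e) rewrite P′≡Q′ =
      +-cancelʳ-≡ u (P % K) (Q % K) (double-inj {P % K + u} {Q % K + u} (suc-injective e))
      where u = label k (Q / K)

  -- Induction on the number of digits: the leading parts satisfy the same hypotheses, and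
  -- `digits-rigid` treats the last digits.
  rigid : ∀ k {P Q R a b c d} → label k P ≢ label k Q → label k Q < label k R →
          a ∈ columns k P → c ∈ columns k P → a ∈ columns k Q → d ∈ columns k Q →
          b ∈ columns k R → d ∈ columns k R → a ≤ b → b ≤ c → c ≤ d → a ≡ d
  rigid zero _ _ _ _ (here refl) (here refl) _ _ _ _ _ = refl
  rigid (suc k) {P} {Q} {R} P≢Q Q<R aP cP aQ dQ bR dR a≤b b≤c c≤d
    with a′ , a₀ , aP′ , aP₀ , a₀<B , refl ← split k P aP
       | c′ , c₀ , cP′ , cP₀ , c₀<B , refl ← split k P cP
       | a″ , a₁ , aQ′ , aQ₀ , a₁<B , a≡ ← split k Q aQ
       | d′ , d₀ , dQ′ , dQ₀ , d₀<B , refl ← split k Q dQ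
       | b′ , b₀ , bR′ , bR₀ , b₀<B , refl ← split k R bR
       | d″ , d₁ , dR′ , dR₀ , d₁<B , d≡ ← split k R dR
    with refl , refl ← digits-unique a′ a″ a₀<B a₁<B a≡ | refl , refl ← digits-unique d′ d″ d₀<B d₁<B d≡
    with a′≤b′ ← quot-mono a′ b′ b₀<B a≤b | b′≤c′ ← quot-mono b′ c′ c₀<B b≤c | c′≤d′ ← quot-mono c′ d′ d₀<B c≤d
    with refl ← rigid k P≢Q Q<R aP′ cP′ aQ′ dQ′ bR′ dR′ a′≤b′ b′≤c′ c′≤d′
    -- Since a′ = d′, all four leading parts agree, and the order of the columns becomes that of
    -- their last digits.
    with refl ← ≤-antisym a′≤b′ (≤-trans b′≤c′ c′≤d′) | refl ← ≤-antisym c′≤d′ (≤-trans a′≤b′ b′≤c′) =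
    cong (_+ a′ * B) (digits-rigid {p = P % K} {q = Q % K} {r = R % K} P≢Q Q<R aP₀ cP₀ aQ₀ dQ₀ bR₀ dR₀
      (+-cancelʳ-≤ (a′ * B) a₀ b₀ a≤b) (+-cancelʳ-≤ (a′ * B) b₀ c₀ b≤c) (+-cancelʳ-≤ (a′ * B) c₀ d₀ c≤d))

  -- Avoidance of the two patterns, and the weight

  row : ℕ → ∀ n → ℕ → Vec _ n
  row k n r = tabulate λ j → does (toℕ j ∈? columns k r)

  -- The top left n × n corner of an infinite diagonal arrangement of copies, so a copy may be cut
  -- off. Avoidance survives this; the weight bound counts complete copies only.
  matrix : ℕ → ∀ n → Matrix n n
  matrix k n = tabulate λ i → row k n (toℕ i)

  entry-matrix : ∀ k n (i j : Fin n) → entry (matrix k n) i j ≡ does (toℕ j ∈? columns k (toℕ i))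
  entry-matrix k n i j =
    trans (cong (λ v → lookup v j) (lookup∘tabulate _ i)) (lookup∘tabulate _ j)

  edge : ∀ k n (i j : Fin n) → true Bool.≤ entry (matrix k n) i j → toℕ j ∈ columns k (toℕ i)
  edge k n i j 1≤ = holds (toℕ j ∈? columns k (toℕ i)) (subst (true Bool.≤_) (entry-matrix k n i j) 1≤)
    where
    holds : ∀ {P : Set} (P? : Dec P) → true Bool.≤ does P? → P
    holds (yes p) _ = p

  embedding-edge : ∀ {k n p q} (S : Matrix p q) {r c} → Embeds S (matrix k n) r c →
                   ∀ i j → {T (entry S i j)} → toℕ (c j) ∈ columns k (toℕ (r i))
  embedding-edge {k} {n} S {r} {c} (_ , _ , S≤) i j {Sᵢⱼ} =
    edge k n (r i) (c j) (subst (Bool._≤ _) (Equivalence.to T-≡ Sᵢⱼ) (S≤ i j))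

  -- In the notation of `rigid`, the rows are P, Q, R from top to bottom and the columns are a, b,
  -- c, d; the conclusion a = d is absurd.
  avoids-S₀ : ∀ k n → matrix k n Avoids S₀
  avoids-S₀ k n (r , c , E@(r↑ , c↑ , _)) =
    <⇒≢ (c↑ {# 0} {# 3} z<s)
      (rigid k (<⇒≢ (label-mono k (r↑ {# 0} {# 1} z<s) (e (# 0) (# 0)) (e (# 1) (# 0))))
        (label-mono k (r↑ {# 1} {# 2} (s<s z<s)) (e (# 1) (# 3)) (e (# 2) (# 3)))
        (e (# 0) (# 0)) (e (# 0) (# 2)) (e (# 1) (# 0)) (e (# 1) (# 3)) (e (# 2) (# 1)) (e (# 2) (# 3))
        (<⇒≤ (c↑ {# 0} {# 1} z<s)) (<⇒≤ (c↑ {# 1} {# 2} (s<s z<s))) (<⇒≤ (c↑ {# 2} {# 3} (s<s (s<s z<s)))))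
    where
    e : ∀ i j → {T (entry S₀ i j)} → toℕ (c j) ∈ columns k (toℕ (r i))
    e i j {t} = embedding-edge {k} {n} S₀ E i j {t}

  -- Here the top row is Q and the middle row is P.
  avoids-S₁ : ∀ k n → matrix k n Avoids S₁
  avoids-S₁ k n (r , c , E@(r↑ , c↑ , _)) =
    <⇒≢ (c↑ {# 0} {# 3} z<s)
      (rigid k (>⇒≢ (label-mono k (r↑ {# 0} {# 1} z<s) (e (# 0) (# 0)) (e (# 1) (# 0))))
        (label-mono k (r↑ {# 0} {# 2} z<s) (e (# 0) (# 3)) (e (# 2) (# 3)))
        (e (# 1) (# 0)) (e (# 1) (# 2)) (e (# 0) (# 0)) (e (# 0) (# 3)) (e (# 2) (# 1)) (e (# 2) (# 3))
        (<⇒≤ (c↑ {# 0} {# 1} z<s)) (<⇒≤ (c↑ {# 1} {# 2} (s<s z<s))) (<⇒≤ (c↑ {# 2} {# 3} (s<s (s<s z<s)))))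
    where
    e : ∀ i j → {T (entry S₁ i j)} → toℕ (c j) ∈ columns k (toℕ (r i))
    e i j {t} = embedding-edge {k} {n} S₁ E i j {t}

  2^k≤count-row : ∀ {L} k n r → r < L * U * K ^ k → L * B ^ k ≤ n → 2 ^ k ≤ count T? (row k n r)
  2^k≤count-row {L} k n r r< C≤n = subst (_≤ count T? (row k n r)) (length-columns k r)
    (length≤count (row k n r) (columns-unique k r) (All.tabulate true-at))
    where
    true-at : ∀ {c} → c ∈ columns k r → ∃ λ j → toℕ j ≡ c × lookup (row k n r) j ≡ true
    true-at c∈ = fromℕ< c<n , toℕ-fromℕ< c<n ,
      trans (lookup∘tabulate _ (fromℕ< c<n))
            (dec-true (_ ∈? columns k r) (subst (_∈ columns k r) (sym (toℕ-fromℕ< c<n)) c∈))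
      where c<n = <-≤-trans (columns<L*B^k {L} k r r< c∈) C≤n

  -- The L copies have L U Kᵏ rows and L Bᵏ columns; once both fit, each of these rows keeps all its
  -- 2ᵏ ones.
  weight-matrix : ∀ {L} k n → L * U * K ^ k ≤ n → L * B ^ k ≤ n →
                  L * U * K ^ k * 2 ^ k ≤ weight (matrix k n)
  weight-matrix {L} k n R≤n C≤n =
    subst (L * U * K ^ k * 2 ^ k ≤_) (sym (sum-map-tabulate (count T?) (λ (i : Fin n) → row k n (toℕ i))))
      (R*d≤sum _ R≤n λ i i< → 2^k≤count-row {L} k n (toℕ i) i< C≤n)

-- The number of ones

-- An integer-valued form of Bernoulli's inequality (w / (w + 1))ʲ ≥ 1 − j / (w + 1).
bernoulli : ∀ w j e → e + j ≡ suc w → suc w ^ j * e ≤ w ^ j * suc w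
bernoulli w zero    e eq = ≤-reflexive (cong (1 *_) (trans (sym (+-identityʳ e)) eq))
bernoulli w (suc j) e eq = begin
  suc w * suc w ^ j * e      ≡⟨ rotate (suc w) (suc w ^ j) e ⟩
  suc w ^ j * (suc w * e)    ≤⟨ *-monoʳ-≤ (suc w ^ j) (+-mono-≤ e≤w ≤-refl) ⟩
  suc w ^ j * (w + w * e)    ≡⟨ cong (suc w ^ j *_) (*-suc w e) ⟨
  suc w ^ j * (w * suc e)    ≡⟨ rotate w (suc w ^ j) (suc e) ⟨
  w * suc w ^ j * suc e      ≡⟨ *-assoc w (suc w ^ j) (suc e) ⟩
  w * (suc w ^ j * suc e)    ≤⟨ *-monoʳ-≤ w (bernoulli w j (suc e) eq′) ⟩
  w * (w ^ j * suc w)        ≡⟨ *-assoc w (w ^ j) (suc w) ⟨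
  w * w ^ j * suc w          ∎
  where
  open ≤-Reasoning
  eq′ : suc e + j ≡ suc w
  eq′ = trans (sym (+-suc e j)) eq
  e≤w : e ≤ w
  e≤w = ≤-trans (m≤m+n e j) (≤-reflexive (suc-injective eq′))
  rotate : ∀ a b c → a * b * c ≡ b * (a * c)
  rotate = solve-∀

-- In `bernoulli` with j = m, the number e = w + 1 - m is at least (w + 1) / 2. With K = U w this
-- bounds by 2 the total loss, over m digits, from columns ranging over K + U values instead of K.
suc^≤2*^ : ∀ w m → 2 * m ≤ suc w → suc w ^ m ≤ 2 * w ^ m
suc^≤2*^ w m 2m≤ = *-cancelʳ-≤ _ _ (suc w) (begin
  suc w ^ m * suc w          ≤⟨ *-monoʳ-≤ (suc w ^ m) w<2e ⟩
  suc w ^ m * (2 * e)        ≡⟨ swap (suc w ^ m) e ⟩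
  2 * (suc w ^ m * e)        ≤⟨ *-monoʳ-≤ 2 (bernoulli w m e e+m) ⟩
  2 * (w ^ m * suc w)        ≡⟨ *-assoc 2 (w ^ m) (suc w) ⟨
  2 * w ^ m * suc w          ∎)
  where
  open ≤-Reasoning
  swap : ∀ a b → a * (2 * b) ≡ 2 * (a * b)
  swap = solve-∀
  e = suc w ∸ m
  e+m : e + m ≡ suc w
  e+m = m∸n+n≡m (≤-trans (m≤m+n m (m + 0)) 2m≤)
  w<2e : suc w ≤ 2 * e
  w<2e = +-cancelʳ-≤ (2 * m) (suc w) (2 * e) (begin
    suc w + 2 * m     ≤⟨ +-monoʳ-≤ (suc w) 2m≤ ⟩
    suc w + suc w     ≡⟨ cong₂ _+_ e+m e+m ⟨
    e + m + (e + m)   ≡⟨ double e m ⟩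
    2 * e + 2 * m     ∎)
    where
    double : ∀ a b → a + b + (a + b) ≡ 2 * a + 2 * b
    double = solve-∀

*-^-distrib : ∀ a b k → (a * b) ^ k ≡ a ^ k * b ^ k
*-^-distrib a b zero    = refl
*-^-distrib a b (suc k) =
  trans (cong (a * b *_) (*-^-distrib a b k)) ([m*n]*[o*p]≡[m*o]*[n*p] a b (a ^ k) (b ^ k))

-- With U = 2ᵐ and K = U w, the base B = 2U(w + 1) is a power of 2 and one copy has N = Bᵐ columns.
-- Of the factor 4, one 2 comes from rounding n / N down and the other from `suc^≤2*^`.
dense : ∀ m l w n .{{_ : NonZero w}} → 2 ^ l ≡ suc w → 2 * m ≤ suc w → 2 ^ (m * (m + l + 1)) ≤ n →
        ∀ {a b} {P : Matrix a b} →
        (∀ U K .{{_ : NonZero U}} .{{_ : NonZero K}} → Construction.matrix U K m n Avoids P) →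
        2 ^ m * n ≤ 4 * Ex P n
dense m l w n 2^l≡ 2m≤2^l N≤n {P = P} avoids = begin
    2 ^ m * n                         ≤⟨ *-monoʳ-≤ (2 ^ m) (<⇒≤ n<) ⟩
    2 ^ m * (suc L * N)               ≤⟨ *-monoʳ-≤ (2 ^ m) (*-monoˡ-≤ N (+-monoˡ-≤ L 1≤L)) ⟩
    2 ^ m * ((L + L) * N)             ≡⟨ cong (λ x → 2 ^ m * ((L + L) * x)) N≡ ⟩
    2 ^ m * ((L + L) * ((2 * U) ^ m * suc w ^ m))
      ≤⟨ *-monoʳ-≤ (2 ^ m) (*-monoʳ-≤ (L + L) (*-monoʳ-≤ ((2 * U) ^ m) (suc^≤2*^ w m 2m≤2^l))) ⟩
    2 ^ m * ((L + L) * ((2 * U) ^ m * (2 * w ^ m)))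
      ≡⟨ cong (λ x → 2 ^ m * ((L + L) * (x * (2 * w ^ m)))) (*-^-distrib 2 U m) ⟩
    -- The factor 2ᵐ of the column count, due to the bits t, equals U, the number of labels; this
    -- balances rows and columns.
    2 ^ m * ((L + L) * (U * U ^ m * (2 * w ^ m)))
      ≡⟨ regroup U L (U ^ m) (w ^ m) ⟩
    4 * (L * U * (U ^ m * w ^ m) * 2 ^ m)
      ≡⟨ cong (λ x → 4 * (L * U * x * 2 ^ m)) (*-^-distrib U w m) ⟨
    4 * (L * U * K ^ m * 2 ^ m)       ≤⟨ *-monoʳ-≤ 4 (weight-matrix {L} m n R≤n LN≤n) ⟩
    4 * weight (matrix m n)           ≤⟨ *-monoʳ-≤ 4 (weight≤Ex P (matrix m n) (avoids U K)) ⟩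
    4 * Ex P n                        ∎
  where
  open ≤-Reasoning
  U = 2 ^ m
  K = U * w
  instance
    U≢0 : NonZero U
    U≢0 = m^n≢0 2 m
    K≢0 : NonZero K
    K≢0 = m*n≢0 U w
  open Construction U K
  N = B ^ m
  instance
    B≢0 : NonZero B
    B≢0 = m*n≢0 2 (K + U) {{_}} {{>-nonZero (<-≤-trans (>-nonZero⁻¹ U) (m≤n+m U K))}}
    N≢0 : NonZero N
    N≢0 = m^n≢0 B m
  L = n / N
  B≡ : B ≡ 2 * U * suc w
  B≡ = factor U w
    where
    factor : ∀ u w → 2 * (u * w + u) ≡ 2 * u * suc w
    factor = solve-∀
  N≡ : N ≡ (2 * U) ^ m * suc w ^ m
  N≡ = trans (cong (_^ m) B≡) (*-^-distrib (2 * U) (suc w) m)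
  N≡2^ : N ≡ 2 ^ (m * (m + l + 1))
  N≡2^ = begin-equality
    B ^ m                    ≡⟨ cong (_^ m) B≡ ⟩
    (2 * U * suc w) ^ m      ≡⟨ cong (λ x → (2 * U * x) ^ m) 2^l≡ ⟨
    (2 ^ suc m * 2 ^ l) ^ m  ≡⟨ cong (_^ m) (^-distribˡ-+-* 2 (suc m) l) ⟨
    (2 ^ (suc m + l)) ^ m    ≡⟨ ^-*-assoc 2 (suc m + l) m ⟩
    2 ^ ((suc m + l) * m)    ≡⟨ cong (2 ^_) (arrange m l) ⟩
    2 ^ (m * (m + l + 1))    ∎
    where
    arrange : ∀ m l → (suc m + l) * m ≡ m * (m + l + 1)
    arrange = solve-∀
  LN≤n : L * N ≤ n
  LN≤n = m/n*n≤m n N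
  n< : n < suc L * N
  n< = begin-strict
    n                ≡⟨ m≡m%n+[m/n]*n n N ⟩
    n % N + L * N    <⟨ +-monoˡ-< (L * N) (m%n<n n N) ⟩
    suc L * N        ∎
  1≤L : 1 ≤ L
  1≤L = m≥n⇒m/n>0 (≤-trans (≤-reflexive N≡2^) N≤n)
  R≤n : L * U * K ^ m ≤ n
  R≤n = begin
    L * U * K ^ m          ≡⟨ *-assoc L U (K ^ m) ⟩
    L * (2 ^ m * K ^ m)    ≡⟨ cong (L *_) (*-^-distrib 2 K m) ⟨
    L * (2 * K) ^ m        ≤⟨ *-monoʳ-≤ L (^-monoˡ-≤ m (*-monoʳ-≤ 2 (m≤m+n K U))) ⟩
    L * N                  ≤⟨ LN≤n ⟩
    n                      ∎
  regroup : ∀ u l a b → u * ((l + l) * (u * a * (2 * b))) ≡ 4 * (l * u * (a * b) * u)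
  regroup = solve-∀

-- Integer logarithms, integer square roots and the choice of m

crossing : (f : ℕ → ℕ) {t : ℕ} (N : ℕ) → f 0 ≤ t → t < f N → ∃ λ k → f k ≤ t × t < f (suc k)
crossing f zero    lo hi = ⊥-elim (<⇒≱ hi lo)
crossing f {t} (suc N) lo hi with f N ≤? t
... | yes fN≤t = N , fN≤t , hi
... | no  fN≰t = crossing f N lo (≰⇒> fN≰t)

n<2^n : ∀ n → n < 2 ^ n
n<2^n zero    = z<s
n<2^n (suc n) = begin-strict
  suc n            <⟨ +-mono-≤-< (m^n>0 2 n) (n<2^n n) ⟩
  2 ^ n + 2 ^ n    ≡⟨ cong (2 ^ n +_) (+-identityʳ (2 ^ n)) ⟨
  2 ^ suc n        ∎
  where open ≤-Reasoning

binary-log : ∀ n → 1 ≤ n → ∃ λ t → 2 ^ t ≤ n × n < 2 ^ suc t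
binary-log n 1≤n = crossing (2 ^_) n 1≤n (n<2^n n)

exponent≤ : ∀ {j t n} → 2 ^ j ≤ n → n < 2 ^ suc t → j ≤ t
exponent≤ lo hi = ≮⇒≥ λ t<j → <⇒≱ hi (≤-trans (^-monoʳ-≤ 2 t<j) lo)

square-root : ∀ t → ∃ λ s → s * s ≤ t × t < suc s * suc s
square-root t = crossing (λ s → s * s) (suc t) z≤n (m≤m*n (suc t) (suc t))

-- Here t, s and p are the integer parts of log n, √t and log t.
record Parameters (n : ℕ) : Set where
  field
    t s p : ℕ
    2^t≤n : 2 ^ t ≤ n
    n<2^t : n < 2 ^ suc t
    s²≤t  : s * s ≤ t
    t<s²  : t < suc s * suc s
    2^p≤t : 2 ^ p ≤ t
    t<2^p : t < 2 ^ suc p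
    1≤p   : 1 ≤ p

  -- For l = p + 2 the subtracted p + 3 is l + 1, so m (m + l + 1) = m s ≤ t if s ≥ p + 3. Otherwise
  -- truncation gives m = 0, and one copy has a single column.
  m : ℕ
  m = s ∸ (p + 3)

  s≤m+p+3 : s ≤ m + (p + 3)
  s≤m+p+3 = subst (s ≤_) (+-comm (p + 3) m) (m≤n+m∸n s (p + 3))

  s≤t : s ≤ t
  s≤t with s | s²≤t
  ... | zero  | _    = z≤n
  ... | suc s | s²≤t = ≤-trans (m≤m*n (suc s) (suc s)) s²≤t

  2m≤ : 2 * m ≤ 2 ^ (p + 2)
  2m≤ = begin
    2 * m           ≤⟨ *-monoʳ-≤ 2 (m∸n≤m s (p + 3)) ⟩
    2 * s           ≤⟨ *-monoʳ-≤ 2 (≤-trans s≤t (<⇒≤ t<2^p)) ⟩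
    2 ^ (2 + p)     ≡⟨ cong (2 ^_) (+-comm 2 p) ⟩
    2 ^ (p + 2)     ∎
    where open ≤-Reasoning

  size≤n : 2 ^ (m * (m + (p + 2) + 1)) ≤ n
  size≤n = ≤-trans (^-monoʳ-≤ 2 (exponent (≤-total s (p + 3)))) 2^t≤n
    where
    open ≤-Reasoning
    shift : ∀ a b → a + (b + 2) + 1 ≡ a + (b + 3)
    shift = solve-∀
    exponent : s ≤ p + 3 ⊎ p + 3 ≤ s → m * (m + (p + 2) + 1) ≤ t
    exponent (inj₁ s≤) = subst (λ m → m * (m + (p + 2) + 1) ≤ t) (sym (m≤n⇒m∸n≡0 s≤)) z≤n
    exponent (inj₂ ≤s) = begin
      m * (m + (p + 2) + 1)  ≡⟨ cong (m *_) (shift m p) ⟩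
      m * (m + (p + 3))      ≡⟨ cong (m *_) (m∸n+n≡m ≤s) ⟩
      m * s                  ≤⟨ *-monoˡ-≤ s (m∸n≤m s (p + 3)) ⟩
      s * s                  ≤⟨ s²≤t ⟩
      t                      ∎

  Ex-lower-bound : ∀ {a b} {P : Matrix a b} →
                   (∀ U K .{{_ : NonZero U}} .{{_ : NonZero K}} → Construction.matrix U K m n Avoids P) →
                   2 ^ m * n ≤ 4 * Ex P n
  Ex-lower-bound {P = P} avoids =
    dense m (p + 2) w n {{>-nonZero 0<w}} 2^l≡ (subst (2 * m ≤_) 2^l≡ 2m≤) size≤n {P = P} avoids
    where
    w = pred (2 ^ (p + 2))
    2^l≡ : 2 ^ (p + 2) ≡ suc w
    2^l≡ = sym (suc-pred (2 ^ (p + 2)) {{m^n≢0 2 (p + 2)}})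
    0<w : 0 < w
    0<w = s<s⁻¹ (subst (1 <_) 2^l≡ (^-monoʳ-< 2 (s≤s (s≤s z≤n)) {0} (m≤n⇒m≤o+n p z<s)))

parameters : ∀ n → 4 ≤ n → Parameters n
parameters n 4≤n
  with t , 2^t≤n , n<2^t ← binary-log n (≤-trans z<s 4≤n)
  with s , s²≤t , t<s² ← square-root t
  -- The threshold 4 gives t ≥ 2 and hence p ≥ 1, which the final estimate uses to absorb constants.
  with 2≤t ← exponent≤ {2} {t} 4≤n n<2^t
  with p , 2^p≤t , t<2^p ← binary-log t (<⇒≤ 2≤t) = record
  { t = t ; s = s ; p = p
  ; 2^t≤n = 2^t≤n ; n<2^t = n<2^t ; s²≤t = s²≤t ; t<s² = t<s² ; 2^p≤t = 2^p≤t ; t<2^p = t<2^p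
  ; 1≤p = exponent≤ {1} {p} 2≤t t<2^p }

-- Rational exponents and cuts

<⇒≱ℚ : ∀ {x y} → x ℚ.< y → ¬ y ℚ.≤ x
<⇒≱ℚ x<y y≤x = ℚ.<-irrefl refl (ℚ.<-≤-trans x<y y≤x)

ι : ℤ → ℚ
ι i = i ℚ./ 1

-- Replaces the normalising quotient by a reduced fraction, whose numerator and denominator can be
-- read off.
ι≡mkℚ : ∀ i → ι i ≡ mkℚ i 0 (coprime-sym (1-coprimeTo _))
ι≡mkℚ i = ℚ.↥p/↧p≡p (mkℚ i 0 _)

ι-homo-+ : ∀ i j → ι i ℚ.+ ι j ≡ ι (i ℤ.+ j)
ι-homo-+ i j = trans (cong₂ ℚ._+_ (ι≡mkℚ i) (ι≡mkℚ j))
  (cong ι (cong₂ ℤ._+_ (ℤ.*-identityʳ i) (ℤ.*-identityʳ j)))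

ι-homo-* : ∀ i j → ι i ℚ.* ι j ≡ ι (i ℤ.* j)
ι-homo-* i j = cong₂ ℚ._*_ (ι≡mkℚ i) (ι≡mkℚ j)

ι-mono-≤ : ∀ {i j} → i ℤ.≤ j → ι i ℚ.≤ ι j
ι-mono-≤ {i} {j} i≤j = subst₂ ℚ._≤_ (sym (ι≡mkℚ i)) (sym (ι≡mkℚ j)) (*≤* (ℤ.*-monoʳ-≤-nonNeg (ℤ.+ 1) i≤j))

ι-cancel-< : ∀ {i j} → ι i ℚ.< ι j → i ℤ.< j
ι-cancel-< ιi<ιj = ℤ.≰⇒> λ j≤i → <⇒≱ℚ ιi<ιj (ι-mono-≤ j≤i)

≤ι⇒↥≤ : ∀ {q k} → q ℚ.≤ ι k → ℚ.↥ q ℤ.≤ k ℤ.* ℚ.↧ q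
≤ι⇒↥≤ {q} {k} q≤k with *≤* le ← subst (q ℚ.≤_) (ι≡mkℚ k) q≤k = subst (ℤ._≤ k ℤ.* ℚ.↧ q) (ℤ.*-identityʳ (ℚ.↥ q)) le

ι≤⇒≤↥ : ∀ {q k} → ι k ℚ.≤ q → k ℤ.* ℚ.↧ q ℤ.≤ ℚ.↥ q
ι≤⇒≤↥ {q} {k} k≤q with *≤* le ← subst (ℚ._≤ q) (ι≡mkℚ k) k≤q = subst (k ℤ.* ℚ.↧ q ℤ.≤_) (ℤ.*-identityʳ (ℚ.↥ q)) le

0≤ι : ∀ n → 0ℚ ℚ.≤ ι (ℤ.+ n)
0≤ι n = ι-mono-≤ {ℤ.+ 0} {ℤ.+ n} (ℤ.+≤+ z≤n)

^ℚ-nonNeg : ∀ {x} → 0ℚ ℚ.≤ x → ∀ n → 0ℚ ℚ.≤ x ^ℚ n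
^ℚ-nonNeg 0≤x zero    = *≤* (ℤ.+≤+ z≤n)
^ℚ-nonNeg {x} 0≤x (suc n) = subst (ℚ._≤ x ℚ.* x ^ℚ n) (ℚ.*-zeroʳ x)
  (ℚ.*-monoˡ-≤-nonNeg x {{ℚ.nonNegative 0≤x}} (^ℚ-nonNeg 0≤x n))

^ℚ-mono-< : ∀ {x y} → 0ℚ ℚ.≤ x → x ℚ.< y → ∀ n → x ^ℚ suc n ℚ.< y ^ℚ suc n
^ℚ-mono-< {x} {y} 0≤x x<y zero = ℚ.*-monoˡ-<-pos 1ℚ x<y
^ℚ-mono-< {x} {y} 0≤x x<y (suc n) = ℚ.≤-<-trans
  (ℚ.*-monoʳ-≤-nonNeg (x ^ℚ suc n) {{ℚ.nonNegative (^ℚ-nonNeg 0≤x (suc n))}} (ℚ.<⇒≤ x<y))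
  (ℚ.*-monoʳ-<-pos y {{ℚ.positive (ℚ.≤-<-trans 0≤x x<y)}} (^ℚ-mono-< 0≤x x<y n))

0≤2^ℤ : ∀ i → 0ℚ ℚ.≤ 2^ℤ i
0≤2^ℤ (ℤ.+ n)    = ^ℚ-nonNeg (*≤* (ℤ.+≤+ z≤n)) n
0≤2^ℤ -[1+ n ] = ^ℚ-nonNeg {½} (*≤* (ℤ.+≤+ z≤n)) (suc n)

1≤2^ : ∀ n → 1ℚ ℚ.≤ ι (ℤ.+ 2) ^ℚ n
1≤2^ zero    = ℚ.≤-refl
1≤2^ (suc n) = ℚ.≤-trans (1≤2^ n) (ℚ.≤-trans (ℚ.≤-reflexive (sym (ℚ.*-identityˡ _)))
  (ℚ.*-monoʳ-≤-nonNeg (ι (ℤ.+ 2) ^ℚ n) {{ℚ.nonNegative (0≤2^ℤ (ℤ.+ n))}} {1ℚ} {ι (ℤ.+ 2)} (*≤* (ℤ.+≤+ (s≤s z≤n)))))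

2^-mono : ∀ {m n} → m ≤ n → ι (ℤ.+ 2) ^ℚ m ℚ.≤ ι (ℤ.+ 2) ^ℚ n
2^-mono {n = n} z≤n = 1≤2^ n
2^-mono (s≤s m≤n)   = ℚ.*-monoˡ-≤-nonNeg (ι (ℤ.+ 2)) (2^-mono m≤n)

½^≤1 : ∀ n → ½ ^ℚ n ℚ.≤ 1ℚ
½^≤1 zero    = ℚ.≤-refl
½^≤1 (suc n) = ℚ.≤-trans (ℚ.*-monoˡ-≤-nonNeg ½ (½^≤1 n)) (*≤* (ℤ.+≤+ (s≤s z≤n)))

½^-anti : ∀ {m n} → m ≤ n → ½ ^ℚ n ℚ.≤ ½ ^ℚ m
½^-anti {n = n} z≤n = ½^≤1 n
½^-anti (s≤s m≤n)   = ℚ.*-monoˡ-≤-nonNeg ½ (½^-anti m≤n)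

2^ℤ-mono : ∀ {i j} → i ℤ.≤ j → 2^ℤ i ℚ.≤ 2^ℤ j
2^ℤ-mono (ℤ.-≤- n≤m)         = ½^-anti (s≤s n≤m)
2^ℤ-mono (ℤ.-≤+ {m} {n})     = ℚ.≤-trans (½^≤1 (suc m)) (1≤2^ n)
2^ℤ-mono (ℤ.+≤+ m≤n)         = 2^-mono m≤n

2^ℤ-homo : ∀ k b → 2^ℤ (k ℤ.* ℤ.+ suc b) ≡ 2^ℤ k ^ℚ suc b
2^ℤ-homo (ℤ.+ a)    b = trans (cong 2^ℤ (sym (ℤ.pos-* a (suc b)))) (sym (^-assocʳ (ι (ℤ.+ 2)) a (suc b)))
2^ℤ-homo -[1+ a ] b = sym (^-assocʳ ½ (suc a) (suc b))

-- If q = a/b were at most k, then a ≤ k b and 2ᵃ ≤ (2ᵏ)ᵇ < rᵇ, against the bound on r.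
2^ℤ<⇒ι< : ∀ k {r q} → 2^ℤ k ℚ.< r → r ≤2^ q → ι k ℚ.< q
2^ℤ<⇒ι< k 2^k<r (inj₁ r≤0) = ⊥-elim (<⇒≱ℚ 2^k<r (ℚ.≤-trans r≤0 (0≤2^ℤ k)))
2^ℤ<⇒ι< k {r} {q@record{}} 2^k<r (inj₂ r^b≤) = ℚ.≰⇒> λ q≤k → <⇒≱ℚ
  (ℚ.≤-<-trans (ℚ.≤-trans (2^ℤ-mono (≤ι⇒↥≤ {q} {k} q≤k)) (ℚ.≤-reflexive (2^ℤ-homo k (ℚ.denominator-1 q))))
               (^ℚ-mono-< (0≤2^ℤ k) 2^k<r (ℚ.denominator-1 q)))
  r^b≤

<2^ℤ⇒<ι : ∀ k {r q} → r ℚ.< 2^ℤ k → r ≥2^ q → q ℚ.< ι k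
<2^ℤ⇒<ι k {r} {q@record{}} r<2^k (0<r , ≤r^b) = ℚ.≰⇒> λ k≤q → <⇒≱ℚ
  (^ℚ-mono-< (ℚ.<⇒≤ 0<r) r<2^k (ℚ.denominator-1 q))
  (ℚ.≤-trans (ℚ.≤-reflexive (sym (2^ℤ-homo k (ℚ.denominator-1 q))))
    (ℚ.≤-trans (2^ℤ-mono (ι≤⇒≤↥ {q} {k} k≤q)) ≤r^b))

2^ℤ-+ : ∀ n → 2^ℤ (ℤ.+ n) ≡ ι (ℤ.+ (2 ^ n))
2^ℤ-+ zero    = refl
2^ℤ-+ (suc n) = trans (cong (ι (ℤ.+ 2) ℚ.*_) (2^ℤ-+ n))
  (trans (ι-homo-* (ℤ.+ 2) (ℤ.+ (2 ^ n))) (cong ι (sym (ℤ.pos-* 2 (2 ^ n)))))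

-- Moves the factor 4 of `dense` into the exponent; m - 2 is an integer difference, negative for m <
-- 2.
4*2^ℤ : ∀ m → ι (ℤ.+ 4) ℚ.* 2^ℤ (m ℤ.⊖ 2) ≡ 2^ℤ (ℤ.+ m)
4*2^ℤ zero          = refl
4*2^ℤ (suc zero)    = refl
4*2^ℤ (suc (suc m)) = ℚ.*-assoc (ι (ℤ.+ 2)) (ι (ℤ.+ 2)) (2^ℤ (ℤ.+ m))

-- If s ≤ α, then s² ≤ α², although α² lies in the lower set of x.
√-bound : ∀ {x s α} → (∀ {q} → Lower x q → q ℚ.< ι (ℤ.+ s) ℚ.* ι (ℤ.+ s)) → Lower (√ x) α → α ℚ.< ι (ℤ.+ s)
√-bound {s = s} _ (inj₁ α<0) = ℚ.<-≤-trans α<0 (0≤ι s)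
√-bound {s = s} {α} below (inj₂ α²∈) = ℚ.≰⇒> λ s≤α → <⇒≱ℚ (below α²∈) (ℚ.≤-trans
  (ℚ.*-monoˡ-≤-nonNeg (ι (ℤ.+ s)) {{ℚ.nonNegative (0≤ι s)}} s≤α)
  (ℚ.*-monoʳ-≤-nonNeg α {{ℚ.nonNegative (ℚ.≤-trans (0≤ι s) s≤α)}} s≤α))

log₂-upper : ∀ {x k q} → (∀ {r} → Upper x r → ι (ℤ.+ (2 ^ k)) ℚ.< r) → Upper (log₂ x) q → ι (ℤ.+ k) ℚ.< q
log₂-upper {k = k} above (r , r∈ , r≤2^q) =
  2^ℤ<⇒ι< (ℤ.+ k) (subst (ℚ._< r) (sym (2^ℤ-+ k)) (above r∈)) r≤2^q

log₂-lower : ∀ {x k q} → (∀ {r} → Lower x r → r ℚ.< ι (ℤ.+ (2 ^ k))) → Lower (log₂ x) q → q ℚ.< ι (ℤ.+ k)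
log₂-lower {k = k} below (r , r∈ , r≥2^q) =
  <2^ℤ⇒<ι (ℤ.+ k) (subst (r ℚ.<_) (sym (2^ℤ-+ k)) (below r∈)) r≥2^q

<-⇒+< : ∀ {x y z} → x ℚ.< y ℚ.- z → x ℚ.+ z ℚ.< y
<-⇒+< {x} {y} {z} x<y-z = subst (x ℚ.+ z ℚ.<_) (begin
  y ℚ.- z ℚ.+ z           ≡⟨ ℚ.+-assoc y (ℚ.- z) z ⟩
  y ℚ.+ (ℚ.- z ℚ.+ z)     ≡⟨ cong (y ℚ.+_) (ℚ.+-inverseˡ z) ⟩
  y ℚ.+ 0ℚ                ≡⟨ ℚ.+-identityʳ y ⟩
  y                       ∎) (ℚ.+-monoˡ-< z x<y-z)
  where open ≡-Reasoning

-- From the integer bound to the inequality of cuts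

module _ {n : ℕ} (params : Parameters n) where
  open Parameters params

  -- The lower set of the square root lies below s + 1 and the upper set of log log n above p. So σ
  -- < s + 1 - 7p, which is at most m - 2.
  exponent< : ∀ {σ} → Lower (√ (log₂ (fromℕ n)) ⊖ 7 · log₂ (log₂ (fromℕ n))) σ →
              σ ℚ.< ι (m ℤ.⊖ 2)
  exponent< {σ} (α , β , α∈ , (γ , γ∈ , 7γ<β) , σ<α-β) =
    ℚ.≰⇒> λ m-2≤σ → ℤ.<⇒≱ (ι-cancel-< (sum< m-2≤σ)) integers
    where
    α<s : α ℚ.< ι (ℤ.+ suc s)
    α<s = √-bound {log₂ (fromℕ n)} {suc s} (λ q∈ → ℚ.<-≤-trans
      (log₂-lower {fromℕ n} {suc t} (λ r<n → ℚ.<-≤-trans r<n (ι-mono-≤ (ℤ.+≤+ (<⇒≤ n<2^t)))) q∈)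
      (ℚ.≤-trans (ι-mono-≤ (ℤ.+≤+ t<s²)) (ℚ.≤-reflexive (sym (ι-homo-* (ℤ.+ suc s) (ℤ.+ suc s)))))) α∈
    p<γ : ι (ℤ.+ p) ℚ.< γ
    p<γ = log₂-upper {log₂ (fromℕ n)} {p} (λ q∈ → ℚ.≤-<-trans (ι-mono-≤ (ℤ.+≤+ 2^p≤t))
      (log₂-upper {fromℕ n} {t} (λ n<r → ℚ.≤-<-trans (ι-mono-≤ (ℤ.+≤+ 2^t≤n)) n<r) q∈)) γ∈
    7p<β : ι (ℤ.+ (7 * p)) ℚ.< β
    7p<β = ℚ.≤-<-trans (ℚ.≤-reflexive (trans (cong ι (ℤ.pos-* 7 p)) (sym (ι-homo-* (ℤ.+ 7) (ℤ.+ p)))))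
      (ℚ.<-trans (ℚ.*-monoʳ-<-pos (ι (ℤ.+ 7)) p<γ) 7γ<β)
    sum< : ι (m ℤ.⊖ 2) ℚ.≤ σ → ι (m ℤ.⊖ 2 ℤ.+ ℤ.+ (7 * p)) ℚ.< ι (ℤ.+ suc s)
    sum< m-2≤σ = ℚ.≤-<-trans (ℚ.≤-reflexive (sym (ι-homo-+ (m ℤ.⊖ 2) (ℤ.+ (7 * p)))))
      (ℚ.<-trans (ℚ.+-mono-≤-< m-2≤σ 7p<β) (ℚ.<-trans (<-⇒+< {σ} {α} {β} σ<α-β) α<s))
    -- The constant 7: one p comes from the definition of m, and 6p ≥ 6 covers 1 from s + 1, 3 from
    -- p + 3 and 2 from the factor 4.
    s+3≤ : suc s + 2 ≤ m + 7 * p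
    s+3≤ = begin
      suc s + 2            ≤⟨ +-monoˡ-≤ 2 (s≤s s≤m+p+3) ⟩
      suc (m + (p + 3)) + 2 ≡⟨ arrange m p ⟩
      m + (p + 6 * 1)       ≤⟨ +-monoʳ-≤ m (+-monoʳ-≤ p (*-monoʳ-≤ 6 1≤p)) ⟩
      m + (p + 6 * p)       ≡⟨⟩
      m + 7 * p             ∎
      where
      open ≤-Reasoning
      arrange : ∀ m p → suc (m + (p + 3)) + 2 ≡ m + (p + 6 * 1)
      arrange = solve-∀
    integers : ℤ.+ suc s ℤ.≤ m ℤ.⊖ 2 ℤ.+ ℤ.+ (7 * p)
    integers = begin
      ℤ.+ suc s                   ≡⟨ cong (ℤ._⊖ 2) (+-comm 2 (suc s)) ⟩
      (suc s + 2) ℤ.⊖ 2         ≤⟨ ℤ.⊖-monoˡ-≤ 2 s+3≤ ⟩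
      (m + 7 * p) ℤ.⊖ 2         ≡⟨ ℤ.distribˡ-⊖-+-pos (7 * p) m 2 ⟨
      m ℤ.⊖ 2 ℤ.+ ℤ.+ (7 * p)     ∎
      where open ℤ.≤-Reasoning

  -- Since σ < m - 2, a number r bounded by 2 to the power σ is at most 2 to the power m - 2;
  -- multiplying by 4 reduces the claim to the integer hypothesis.
  2^⊑ : ∀ N → 2 ^ m * n ≤ 4 * N →
        n · 2^ (√ (log₂ (fromℕ n)) ⊖ 7 · log₂ (log₂ (fromℕ n))) ⊑ fromℕ N
  2^⊑ N dense q (r , (σ , σ∈ , r≤2^σ) , q<nr) = ℚ.<-≤-trans q<nr (ℚ.≤-trans
    (ℚ.*-monoˡ-≤-nonNeg (ι (ℤ.+ n)) {{ℚ.nonNegative (0≤ι n)}}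
      (ℚ.≮⇒≥ λ 2^<r → ℚ.<-asym (exponent< σ∈) (2^ℤ<⇒ι< (m ℤ.⊖ 2) 2^<r r≤2^σ)))
    (ℚ.*-cancelˡ-≤-pos (ι (ℤ.+ 4)) (begin
      ι (ℤ.+ 4) ℚ.* (ι (ℤ.+ n) ℚ.* x)  ≡⟨ ℚ.*-assoc (ι (ℤ.+ 4)) (ι (ℤ.+ n)) x ⟨
      ι (ℤ.+ 4) ℚ.* ι (ℤ.+ n) ℚ.* x    ≡⟨ cong (ℚ._* x) (ℚ.*-comm (ι (ℤ.+ 4)) (ι (ℤ.+ n))) ⟩
      ι (ℤ.+ n) ℚ.* ι (ℤ.+ 4) ℚ.* x    ≡⟨ ℚ.*-assoc (ι (ℤ.+ n)) (ι (ℤ.+ 4)) x ⟩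
      ι (ℤ.+ n) ℚ.* (ι (ℤ.+ 4) ℚ.* x)  ≡⟨ cong (ι (ℤ.+ n) ℚ.*_) (trans (4*2^ℤ m) (2^ℤ-+ m)) ⟩
      ι (ℤ.+ n) ℚ.* ι (ℤ.+ (2 ^ m))    ≡⟨ ℚ.*-comm (ι (ℤ.+ n)) (ι (ℤ.+ (2 ^ m))) ⟩
      ι (ℤ.+ (2 ^ m)) ℚ.* ι (ℤ.+ n)    ≡⟨ ι-homo-* (ℤ.+ (2 ^ m)) (ℤ.+ n) ⟩
      ι (ℤ.+ (2 ^ m) ℤ.* ℤ.+ n)        ≡⟨ cong ι (ℤ.pos-* (2 ^ m) n) ⟨
      ι (ℤ.+ (2 ^ m * n))            ≤⟨ ι-mono-≤ (ℤ.+≤+ dense) ⟩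
      ι (ℤ.+ (4 * N))                ≡⟨ cong ι (ℤ.pos-* 4 N) ⟩
      ι (ℤ.+ 4 ℤ.* ℤ.+ N)              ≡⟨ ι-homo-* (ℤ.+ 4) (ℤ.+ N) ⟨
      ι (ℤ.+ 4) ℚ.* ι (ℤ.+ N)          ∎)))
    where
    open ℚ.≤-Reasoning
    x = 2^ℤ (m ℤ.⊖ 2)

theorem1p2 : Σ ℕ λ C → Σ ℕ λ n₀ → ∀ n → n₀ ≤ n →
    (n · 2^ (√ (log₂ (fromℕ n)) ⊖ C · log₂ (log₂ (fromℕ n))) ⊑ fromℕ (Ex S₀ n)) ×
    (n · 2^ (√ (log₂ (fromℕ n)) ⊖ C · log₂ (log₂ (fromℕ n))) ⊑ fromℕ (Ex S₁ n))
theorem1p2 = 7 , 4 , λ n 4≤n →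
  let params = parameters n 4≤n
      open Parameters params in
  2^⊑ params (Ex S₀ n) (Ex-lower-bound {P = S₀} λ U K → Construction.avoids-S₀ U K m n) ,
  2^⊑ params (Ex S₁ n) (Ex-lower-bound {P = S₁} λ U K → Construction.avoids-S₁ U K m n)
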